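{- Let $G$ be a $P_5$-free graph that is minimally non-perfectly divisible. Then $G$ does not contain a clique cutset.
   Context: All graphs are finite and simple. For $S\subseteq V(G)$, $G[S]$ is the subgraph induced by $S$. $\omega(G)$ is the number of vertices in a largest clique of $G$ and $\chi(G)$ the chromatic number. A graph $G$ is perfect if $\chi(H)=\omega(H)$ for every induced subgraph $H$ of $G$. A partition $(A,B)$ of $V(G)$ is good if $G[A]$ is perfect and $\omega(G[B])<\omega(G)$. A graph $G$ is perfectly divisible if every induced subgraph $H$ of $G$ with at least one edge admits a good partition (of $V(H)$). A graph is minimally non-perfectly divisible if it is not perfectly divisible but each of its proper induced subgraphs is perfectly divisible. A set $C\subseteq V(G)$ is a clique cutset if $C$ induces a clique in $G$ and $G-C$ is disconnected. $P_5$ is the chordless path on five vertices; $G$ is $P_5$-free if it has no induced subgraph isomorphic to $P_5$. -}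

module Defs where

open import Data.Bool.Base using (Bool; false; T; _∨_)
open import Data.Bool.Properties using (∨-comm)
open import Data.Empty using (⊥-elim)
open import Data.Fin.Base using (Fin; toℕ; inject₁; fromℕ; fromℕ<)
open import Data.Fin.Properties using (all?; any?; toℕ<n; toℕ-fromℕ<; toℕ-inject₁; toℕ-injective) renaming (_≟_ to _≟ᶠ_)
open import Data.Fin.Subset using (Subset; _∈_; _⊆_; _⊂_; _∪_; _∩_; _─_; ∣_∣; ⊤; ⊥)
open import Data.Fin.Subset.Properties using (_∈?_; _⊆?_; anySubset?; ∣p∣≤n; ∉⊥; ∣⊥∣≡0)
open import Data.Nat.Base using (ℕ; zero; suc; _+_; _≤_; _<_; z≤n; _≡ᵇ_)
open import Data.Nat.Properties using (_≟_; _<?_; ≤∧≢⇒<; m<1+n⇒m≤n; +-identityʳ; +-suc)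
open import Data.Product.Base using (Σ; ∃; ∃-syntax; _×_; _,_; proj₁; proj₂)
open import Data.Vec.Base using (Vec; []; _∷_; lookup; tabulate)
open import Data.Vec.Properties using (lookup∘tabulate)
open import Function.Bundles using (_⇔_; _↔_; module Inverse)
open import Relation.Binary.Construct.Closure.ReflexiveTransitive using (Star)
open import Relation.Binary.PropositionalEquality using (_≡_; _≢_; refl; sym; trans; cong; subst)
open import Relation.Nullary using (¬_; Dec; yes; no; ¬?; T?)
open import Relation.Nullary.Decidable using (_×-dec_; _→-dec_; map′)

-- The vertex set is a subset V of an ambient Fin n, so that an induced
-- subgraph is again a Graph n.  Only the restriction of adj to V carries
-- meaning: every notion below looks at adj on elements of V only.
record Graph (n : ℕ) : Set where
  field
    V          : Subset n
    adj        : Fin n → Fin n → Bool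
    adj-sym    : ∀ u v → adj u v ≡ adj v u
    adj-irrefl : ∀ v → adj v v ≡ false

open Graph public

Vertex : ∀ {n} → Graph n → Set
Vertex {n} G = Σ (Fin n) (_∈ V G)

Adj : ∀ {n} (G : Graph n) → Vertex G → Vertex G → Set
Adj G (u , _) (v , _) = T (adj G u v)

HasEdge : ∀ {n} → Graph n → Set
HasEdge G = ∃[ u ] ∃[ v ] Adj G u v

-- Meaningful, and used, only for S ⊆ V G.
_[_] : ∀ {n} → Graph n → Subset n → Graph n
G [ S ] = record G { V = S }

infix 20 _[_]
infix 4 _≅_

record _≅_ {m n} (G : Graph m) (H : Graph n) : Set where
  field
    bijection : Vertex G ↔ Vertex H
    preserves : ∀ u v → Adj G u v ⇔ Adj H (Inverse.to bijection u) (Inverse.to bijection v)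

-- The empty set counts as a clique.
IsClique : ∀ {n} → Graph n → Subset n → Set
IsClique G C = C ⊆ V G × (∀ u v → u ∈ C → v ∈ C → u ≢ v → T (adj G u v))

HasClique : ∀ {n} → Graph n → ℕ → Set
HasClique G k = ∃[ C ] (IsClique G C × ∣ C ∣ ≡ k)

IsCliqueNumber : ∀ {n} → Graph n → ℕ → Set
IsCliqueNumber G k = HasClique G k × (∀ j → HasClique G j → j ≤ k)

Colourable : ∀ {n} → Graph n → ℕ → Set
Colourable G k = Σ (Vertex G → Fin k) λ c → ∀ u v → Adj G u v → c u ≢ c v

IsChromaticNumber : ∀ {n} → Graph n → ℕ → Set
IsChromaticNumber G k = Colourable G k × (∀ j → Colourable G j → k ≤ j)

module _ {P : ℕ → Set} (P? : ∀ k → Dec (P k)) where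

  greatest : ∀ b → P 0 → (∀ j → P j → j ≤ b) → ∃[ k ] (P k × (∀ j → P j → j ≤ k))
  greatest zero    p₀ bnd = 0 , p₀ , bnd
  greatest (suc b) p₀ bnd with P? (suc b)
  ... | yes p = suc b , p , bnd
  ... | no ¬p = greatest b p₀ λ j pj →
    m<1+n⇒m≤n (≤∧≢⇒< (bnd j pj) λ { refl → ¬p pj })

  least : ∀ b → P b → ∃[ k ] (P k × (∀ j → P j → k ≤ j))
  least b p = search b 0 (λ _ _ → z≤n) (subst P (sym (+-identityʳ b)) p)
    where
    search : ∀ d k → (∀ j → P j → k ≤ j) → P (d + k) → ∃[ m ] (P m × (∀ j → P j → m ≤ j))
    search zero    k low p = k , p , low
    search (suc d) k low p with P? k
    ... | yes q = k , q , low
    ... | no ¬q = search d (suc k)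
      (λ j pj → ≤∧≢⇒< (low j pj) λ { refl → ¬q pj })
      (subst P (sym (+-suc d k)) p)

module _ {n} (G : Graph n) where

  hasClique? : ∀ k → Dec (HasClique G k)
  hasClique? k = anySubset? λ C →
    (C ⊆? V G ×-dec
      all? λ u → all? λ v →
        (u ∈? C) →-dec ((v ∈? C) →-dec (¬? (u ≟ᶠ v) →-dec T? (adj G u v))))
    ×-dec (∣ C ∣ ≟ k)

  cliqueNumber : ∃ (IsCliqueNumber G)
  cliqueNumber = greatest hasClique? n
    (⊥ , ((λ x∈⊥ → ⊥-elim (∉⊥ x∈⊥)) , λ _ _ u∈⊥ → ⊥-elim (∉⊥ u∈⊥)) , ∣⊥∣≡0 n)
    λ { _ (C , _ , refl) → ∣p∣≤n C }

  -- Colourings as vectors over the ambient Fin n, with a spare colour k for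
  -- the non-vertices; a form over which exhaustive search is possible.
  private
    VecColouring : ∀ k → Vec (Fin (suc k)) n → Set
    VecColouring k c =
      (∀ v → v ∈ V G → toℕ (lookup c v) < k) ×
      (∀ u v → u ∈ V G → v ∈ V G → T (adj G u v) → lookup c u ≢ lookup c v)

    anyVec? : ∀ {k m} {Q : Vec (Fin k) m → Set} → (∀ c → Dec (Q c)) → Dec (∃ Q)
    anyVec? {m = zero}  Q? = map′ ([] ,_) (λ { ([] , q) → q }) (Q? [])
    anyVec? {m = suc m} Q? =
      map′ (λ { (x , xs , q) → (x ∷ xs) , q }) (λ { (x ∷ xs , q) → x , xs , q })
        (any? λ x → anyVec? λ xs → Q? (x ∷ xs))

    fromVec : ∀ {k} → ∃ (VecColouring k) → Colourable G k
    fromVec (c , c<k , proper) =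
      (λ (v , v∈V) → fromℕ< (c<k v v∈V)) ,
      λ (u , u∈V) (v , v∈V) uv eq → proper u v u∈V v∈V uv (toℕ-injective
        (trans (sym (toℕ-fromℕ< (c<k u u∈V)))
          (trans (cong toℕ eq) (toℕ-fromℕ< (c<k v v∈V)))))

    toVec : ∀ {k} → Colourable G k → ∃ (VecColouring k)
    toVec {k} (c , proper) = tabulate f , bound , proper′
      where
      f : Fin n → Fin (suc k)
      f v with v ∈? V G
      ... | yes v∈V = inject₁ (c (v , v∈V))
      ... | no _    = fromℕ k

      f-spec : ∀ v → v ∈ V G → ∃[ v∈V ] (toℕ (lookup (tabulate f) v) ≡ toℕ (c (v , v∈V)))
      f-spec v v∈V rewrite lookup∘tabulate f v with v ∈? V G
      ... | yes p = p , toℕ-inject₁ (c (v , p))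
      ... | no ¬p = ⊥-elim (¬p v∈V)

      bound : ∀ v → v ∈ V G → toℕ (lookup (tabulate f) v) < k
      bound v v∈V with p , eq ← f-spec v v∈V = subst (_< k) (sym eq) (toℕ<n (c (v , p)))

      proper′ : ∀ u v → u ∈ V G → v ∈ V G → T (adj G u v) →
                lookup (tabulate f) u ≢ lookup (tabulate f) v
      proper′ u v u∈V v∈V uv eq
        with p , eqᵘ ← f-spec u u∈V | q , eqᵛ ← f-spec v v∈V =
        proper (u , p) (v , q) uv
          (toℕ-injective (trans (sym eqᵘ) (trans (cong toℕ eq) eqᵛ)))

  colourable? : ∀ k → Dec (Colourable G k)
  colourable? k = map′ fromVec toVec (anyVec? λ c →
    (all? λ v → (v ∈? V G) →-dec (toℕ (lookup c v) <? k)) ×-dec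
    (all? λ u → all? λ v → (u ∈? V G) →-dec ((v ∈? V G) →-dec
      (T? (adj G u v) →-dec ¬? (lookup c u ≟ᶠ lookup c v)))))

  chromaticNumber : ∃ (IsChromaticNumber G)
  chromaticNumber = least colourable? n
    (proj₁ , λ { (u , _) (.u , _) uu refl → subst T (adj-irrefl G u) uu })

  ω : ℕ
  ω = proj₁ cliqueNumber

  ω-spec : IsCliqueNumber G ω
  ω-spec = proj₂ cliqueNumber

  χ : ℕ
  χ = proj₁ chromaticNumber

  χ-spec : IsChromaticNumber G χ
  χ-spec = proj₂ chromaticNumber

Perfect : ∀ {n} → Graph n → Set
Perfect G = ∀ S → S ⊆ V G → χ (G [ S ]) ≡ ω (G [ S ])

-- Parts of a partition may be empty.
IsPartition : ∀ {n} → Graph n → Subset n → Subset n → Set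
IsPartition G A B = A ∪ B ≡ V G × A ∩ B ≡ ⊥

IsGoodPartition : ∀ {n} → Graph n → Subset n → Subset n → Set
IsGoodPartition G A B = IsPartition G A B × Perfect (G [ A ]) × ω (G [ B ]) < ω G

PerfectlyDivisible : ∀ {n} → Graph n → Set
PerfectlyDivisible G =
  ∀ S → S ⊆ V G → HasEdge (G [ S ]) → ∃[ A ] ∃[ B ] IsGoodPartition (G [ S ]) A B

MinimallyNonPerfectlyDivisible : ∀ {n} → Graph n → Set
MinimallyNonPerfectlyDivisible G =
  ¬ PerfectlyDivisible G × (∀ S → S ⊂ V G → PerfectlyDivisible (G [ S ]))

Disconnected : ∀ {n} → Graph n → Set
Disconnected G = ∃[ u ] ∃[ v ] ¬ Star (Adj G) u v

IsCliqueCutset : ∀ {n} → Graph n → Subset n → Set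
IsCliqueCutset G C = IsClique G C × Disconnected (G [ V G ─ C ])

path : ∀ n → Graph n
path n = record
  { V          = ⊤
  ; adj        = λ i j → (toℕ j ≡ᵇ suc (toℕ i)) ∨ (toℕ i ≡ᵇ suc (toℕ j))
  ; adj-sym    = λ i j → ∨-comm (toℕ j ≡ᵇ suc (toℕ i)) (toℕ i ≡ᵇ suc (toℕ j))
  ; adj-irrefl = λ i → irr (toℕ i)
  }
  where
  n≢ᵇ1+n : ∀ k → (k ≡ᵇ suc k) ≡ false
  n≢ᵇ1+n zero    = refl
  n≢ᵇ1+n (suc k) = n≢ᵇ1+n k

  irr : ∀ k → (k ≡ᵇ suc k) ∨ (k ≡ᵇ suc k) ≡ false
  irr k rewrite n≢ᵇ1+n k = refl

P₅ : Graph 5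
P₅ = path 5

P₅-free : ∀ {n} → Graph n → Set
P₅-free G = ¬ (∃[ S ] (S ⊆ V G × G [ S ] ≅ P₅))

{-# OPTIONS --safe #-}

-- Take a separation (A , B , C): A and B are nonempty and anticomplete, and C
-- is a clique.  If c ∈ C has non-neighbours in both A and B, then either both
-- A and B contain an edge with exactly one end adjacent to c, and these two
-- edges form a P₅ together with c; or, in A say, there is no such edge, and
-- the non-neighbours of c in A are separated from everything else by C - c.
-- So, shrinking C, we may assume C = D ⊎ E with D complete to A and E complete
-- to B.  By minimality, A ∪ E and B ∪ D have good partitions (X₁ , Y₁) and
-- (X₂ , Y₂), and then (X₁ ∪ X₂ , Y₁ ∪ Y₂) is a good partition of G: a clique
-- of Y₁ ∪ Y₂ lies in Y₁ ∪ D or in Y₂ ∪ E, and D is joined completely to A ∪ E,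
-- which gives ω(Y₁) + ∣D∣ < ω(A ∪ E) + ∣D∣ ≤ ω(G); while X₁ ∪ X₂ arises from the
-- perfect graphs X₁ and X₂ by joining cliques and gluing along a clique.
module Submission where

open import Defs
open import Data.Bool.Base using (true; false; T)
open import Data.Empty using (⊥-elim)
open import Data.Fin.Base using (Fin; zero; suc; toℕ; fromℕ<) renaming (_<_ to _<ᶠ_)
open import Data.Fin.Patterns using (0F; 1F; 2F; 3F; 4F)
open import Data.Fin.Properties using (all?; any?; toℕ<n; toℕ-fromℕ<; toℕ-injective; injective⇒≤; <-cmp) renaming (_≟_ to _≟ᶠ_; suc-injective to sucᶠ-injective)
open import Data.Fin.Subset using (Subset; inside; outside; _∈_; _∉_; _⊆_; _⊂_; _⊃_; _∪_; _∩_; _─_; _-_; ∣_∣; ⁅_⁆; ⊥; Nonempty)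
open import Data.Fin.Subset.Induction using (⊂-wellFounded; ⊃-wellFounded)
open import Data.Fin.Subset.Properties
open import Data.List.Base using (List; []; _∷_; allFin)
open import Data.List.Membership.Propositional using () renaming (_∈_ to _∈ˡ_)
open import Data.List.Membership.Propositional.Properties using (∈-allFin)
open import Data.List.Relation.Unary.Any using (here; there)
open import Data.Nat.Base using (ℕ; zero; suc; _+_; _≤_; _<_; z≤n; s≤s)
open import Data.Nat.Properties using (_≟_; ≤-antisym; <-≤-trans; <-irrefl; m≤m+n; +-suc; +-comm; +-mono-≤; +-monoʳ-<; +-cancelˡ-≡; suc-injective; module ≤-Reasoning)
open import Data.Product.Base using (Σ; ∃; ∃-syntax; _×_; _,_; proj₁; proj₂)
open import Data.Sum.Base using (_⊎_; inj₁; inj₂; [_,_]′) renaming (map to ⊎-map)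
open import Data.Vec.Base using ([]; _∷_; here; there; lookup; tabulate)
open import Data.Vec.Properties using (lookup∘tabulate; lookup⇒[]=; []=⇒lookup)
open import Data.Vec.Properties.WithK using ([]=-irrelevant)
open import Function.Base using (_∘_)
open import Function.Bundles using (mk⇔; mk↔ₛ′)
open import Induction.WellFounded using (Acc; acc)
open import Relation.Binary.Construct.Closure.ReflexiveTransitive using (Star; ε; _◅_; _◅◅_)
open import Relation.Binary.Definitions using (tri<; tri≈; tri>)
open import Relation.Binary.PropositionalEquality using (_≡_; _≢_; refl; sym; trans; cong; cong₂; subst)
open import Relation.Nullary using (¬_; Dec; yes; no; ¬?; T?; does)
open import Relation.Nullary.Decidable using (_×-dec_; _→-dec_; dec-true; dec-false; decidable-stable; toWitness)
import Data.Bool.Properties as Bool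

-- Subsets of Fin n

module _ {n : ℕ} {P : Fin n → Set} (P? : ∀ x → Dec (P x)) where

  comprehension : Subset n
  comprehension = tabulate (λ x → does (P? x))

  ∈-comprehension⁺ : ∀ {x} → P x → x ∈ comprehension
  ∈-comprehension⁺ {x} px =
    lookup⇒[]= x _ (trans (lookup∘tabulate _ x) (dec-true (P? x) px))

  ∈-comprehension⁻ : ∀ {x} → x ∈ comprehension → P x
  ∈-comprehension⁻ {x} x∈
    with P? x | trans (sym (lookup∘tabulate (λ y → does (P? y)) x)) ([]=⇒lookup x∈)
  ... | yes px | _ = px
  ... | no _   | ()

x∈p─q⇒x∉q : ∀ {n} {x : Fin n} (p q : Subset n) → x ∈ p ─ q → x ∉ q
x∈p─q⇒x∉q (_ ∷ p) (_ ∷ q) (there x∈) (there x∈q) = x∈p─q⇒x∉q p q x∈ x∈q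
x∈p─q⇒x∉q (_ ∷ _) (inside ∷ _) () here

∣p∣≡∣p∩q∣+∣p─q∣ : ∀ {n} (p q : Subset n) → ∣ p ∣ ≡ ∣ p ∩ q ∣ + ∣ p ─ q ∣
∣p∣≡∣p∩q∣+∣p─q∣ []            []            = refl
∣p∣≡∣p∩q∣+∣p─q∣ (inside ∷ p)  (inside ∷ q)  = cong suc (∣p∣≡∣p∩q∣+∣p─q∣ p q)
∣p∣≡∣p∩q∣+∣p─q∣ (inside ∷ p)  (outside ∷ q) =
  trans (cong suc (∣p∣≡∣p∩q∣+∣p─q∣ p q)) (sym (+-suc ∣ p ∩ q ∣ ∣ p ─ q ∣))
∣p∣≡∣p∩q∣+∣p─q∣ (outside ∷ p) (inside ∷ q)  = ∣p∣≡∣p∩q∣+∣p─q∣ p q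
∣p∣≡∣p∩q∣+∣p─q∣ (outside ∷ p) (outside ∷ q) = ∣p∣≡∣p∩q∣+∣p─q∣ p q

disjoint⇒∣p∣+∣q∣≤∣p∪q∣ : ∀ {n} (p q : Subset n) → (∀ {x} → x ∈ p → x ∉ q) →
                         ∣ p ∣ + ∣ q ∣ ≤ ∣ p ∪ q ∣
disjoint⇒∣p∣+∣q∣≤∣p∪q∣ p q disj = begin
  ∣ p ∣ + ∣ q ∣                          ≡⟨ +-comm ∣ p ∣ ∣ q ∣ ⟩
  ∣ q ∣ + ∣ p ∣                          ≤⟨ +-mono-≤ (p⊆q⇒∣p∣≤∣q∣ q⊆) (p⊆q⇒∣p∣≤∣q∣ p⊆) ⟩
  ∣ (p ∪ q) ∩ q ∣ + ∣ (p ∪ q) ─ q ∣      ≡⟨ sym (∣p∣≡∣p∩q∣+∣p─q∣ (p ∪ q) q) ⟩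
  ∣ p ∪ q ∣                              ∎
  where
  open ≤-Reasoning
  q⊆ : q ⊆ (p ∪ q) ∩ q
  q⊆ x∈q = x∈p∩q⁺ (q⊆p∪q p q x∈q , x∈q)
  p⊆ : p ⊆ (p ∪ q) ─ q
  p⊆ x∈p = x∈p∧x∉q⇒x∈p─q (p⊆p∪q q x∈p) (disj x∈p)

element : ∀ {n} (p : Subset n) → Fin ∣ p ∣ → Fin n
element (inside ∷ p)  zero    = zero
element (inside ∷ p)  (suc i) = suc (element p i)
element (outside ∷ p) i       = suc (element p i)

element-∈ : ∀ {n} (p : Subset n) i → element p i ∈ p
element-∈ (inside ∷ p)  zero    = here
element-∈ (inside ∷ p)  (suc i) = there (element-∈ p i)
element-∈ (outside ∷ p) i       = there (element-∈ p i)

element-injective : ∀ {n} (p : Subset n) {i j} → element p i ≡ element p j → i ≡ j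
element-injective (inside ∷ p)  {zero}  {zero}  _  = refl
element-injective (inside ∷ p)  {suc i} {suc j} eq =
  cong suc (element-injective p (sucᶠ-injective eq))
element-injective (outside ∷ p) eq =
  element-injective p (sucᶠ-injective eq)

rank : ∀ {n} → Subset n → Fin n → ℕ
rank (_ ∷ p)       zero    = 0
rank (inside ∷ p)  (suc x) = suc (rank p x)
rank (outside ∷ p) (suc x) = rank p x

rank<∣p∣ : ∀ {n} (p : Subset n) {x} → x ∈ p → rank p x < ∣ p ∣
rank<∣p∣ (inside ∷ p)  here       = s≤s z≤n
rank<∣p∣ (inside ∷ p)  (there x∈) = s≤s (rank<∣p∣ p x∈)
rank<∣p∣ (outside ∷ p) (there x∈) = rank<∣p∣ p x∈

rank-injective : ∀ {n} (p : Subset n) {x y} → x ∈ p → y ∈ p → rank p x ≡ rank p y → x ≡ y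
rank-injective (inside ∷ p)  here       here       _  = refl
rank-injective (inside ∷ p)  (there x∈) (there y∈) eq =
  cong suc (rank-injective p x∈ y∈ (suc-injective eq))
rank-injective (outside ∷ p) (there x∈) (there y∈) eq = cong suc (rank-injective p x∈ y∈ eq)

-- Transpositions of colours

swap : ℕ → ℕ → ℕ → ℕ
swap a b x with x ≟ a
... | yes _ = b
... | no _ with x ≟ b
...   | yes _ = a
...   | no _  = x

swap-left : ∀ a b → swap a b a ≡ b
swap-left a b with a ≟ a
... | yes _  = refl
... | no a≢a = ⊥-elim (a≢a refl)

swap-other : ∀ a b {x} → x ≢ a → x ≢ b → swap a b x ≡ x
swap-other a b {x} x≢a x≢b with x ≟ a
... | yes x≡a = ⊥-elim (x≢a x≡a)
... | no _ with x ≟ b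
...   | yes x≡b = ⊥-elim (x≢b x≡b)
...   | no _    = refl

swap-< : ∀ {a b k x} → a < k → b < k → x < k → swap a b x < k
swap-< {a} {b} {k} {x} a<k b<k x<k with x ≟ a
... | yes _ = b<k
... | no _ with x ≟ b
...   | yes _ = a<k
...   | no _  = x<k

swap-injective : ∀ a b {x y} → swap a b x ≡ swap a b y → x ≡ y
swap-injective a b {x} {y} eq with x ≟ a | y ≟ a
... | yes p | yes q = trans p (sym q)
swap-injective a b {x} {y} eq | yes p | no q with y ≟ b
... | yes r = trans p (trans (sym eq) (sym r))
... | no r  = ⊥-elim (r (sym eq))
swap-injective a b {x} {y} eq | no p | yes q with x ≟ b
... | yes r = trans r (trans (sym eq) (sym q))
... | no r  = ⊥-elim (r eq)
swap-injective a b {x} {y} eq | no p | no q with x ≟ b | y ≟ b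
... | yes r | yes s = trans r (sym s)
... | yes r | no s  = ⊥-elim (q (sym eq))
... | no r  | yes s = ⊥-elim (p eq)
... | no r  | no s  = eq

-- Adjacency in a fixed graph

module _ {n : ℕ} (G : Graph n) where

  infix 4 _~_
  _~_ : Fin n → Fin n → Set
  u ~ v = T (adj G u v)

  ~-sym : ∀ {u v} → u ~ v → v ~ u
  ~-sym {u} {v} = subst T (adj-sym G u v)

  ~-irrefl : ∀ {u v} → u ~ v → u ≢ v
  ~-irrefl {u} uu refl = subst T (adj-irrefl G u) uu

  _~?_ : ∀ u v → Dec (u ~ v)
  u ~? v = T? (adj G u v)

  Pairwise : Subset n → Set
  Pairwise K = ∀ u v → u ∈ K → v ∈ K → u ≢ v → u ~ v

  CompleteTo : Subset n → Subset n → Set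
  CompleteTo U D = ∀ {u d} → u ∈ U → d ∈ D → u ~ d

  -- Clique numbers

  ω[_] : Subset n → ℕ
  ω[ S ] = ω (G [ S ])

  maximumClique : ∀ S → ∃[ K ] (K ⊆ S × Pairwise K × ∣ K ∣ ≡ ω[ S ])
  maximumClique S with (K , (K⊆S , pw) , eq) , _ ← ω-spec (G [ S ]) = K , K⊆S , pw , eq

  clique≤ω : ∀ {S K} → K ⊆ S → Pairwise K → ∣ K ∣ ≤ ω[ S ]
  clique≤ω {S} {K} K⊆S pw = proj₂ (ω-spec (G [ S ])) ∣ K ∣ (K , (K⊆S , pw) , refl)

  ω-mono : ∀ {S S′} → S ⊆ S′ → ω[ S ] ≤ ω[ S′ ]
  ω-mono {S} {S′} S⊆S′ with K , K⊆S , pw , eq ← maximumClique S =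
    subst (_≤ ω[ S′ ]) eq (clique≤ω (λ x∈K → S⊆S′ (K⊆S x∈K)) pw)

  ω-⊥ : ω[ ⊥ ] ≡ 0
  ω-⊥ with K , K⊆⊥ , _ , eq ← maximumClique ⊥ =
    trans (sym eq) (≤-antisym (subst (∣ K ∣ ≤_) (∣⊥∣≡0 n) (p⊆q⇒∣p∣≤∣q∣ K⊆⊥)) z≤n)

  ω-nonempty : ∀ {S x} → x ∈ S → 1 ≤ ω[ S ]
  ω-nonempty {S} {x} x∈S = subst (_≤ ω[ S ]) (∣⁅x⁆∣≡1 x) (clique≤ω ⊆S pw)
    where
    ⊆S : ⁅ x ⁆ ⊆ S
    ⊆S y∈ = subst (_∈ S) (sym (x∈⁅y⁆⇒x≡y x y∈)) x∈S
    pw : Pairwise ⁅ x ⁆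
    pw u v u∈ v∈ u≢v = ⊥-elim (u≢v (trans (x∈⁅y⁆⇒x≡y x u∈) (sym (x∈⁅y⁆⇒x≡y x v∈))))

  -- A maximum clique of `U` together with `D` is again a clique. The two are disjoint because a
  -- common vertex would be adjacent to itself.
  ω-join : ∀ {U D S} → Pairwise D → CompleteTo U D → U ⊆ S → D ⊆ S →
           ω[ U ] + ∣ D ∣ ≤ ω[ S ]
  ω-join {U} {D} {S} pwD U~D U⊆S D⊆S with K , K⊆U , pwK , eq ← maximumClique U = begin
    ω[ U ] + ∣ D ∣  ≡⟨ cong (_+ ∣ D ∣) (sym eq) ⟩
    ∣ K ∣ + ∣ D ∣   ≤⟨ disjoint⇒∣p∣+∣q∣≤∣p∪q∣ K D (λ x∈K x∈D → ~-irrefl (U~D (K⊆U x∈K) x∈D) refl) ⟩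
    ∣ K ∪ D ∣       ≤⟨ clique≤ω ⊆S pw ⟩
    ω[ S ]          ∎
    where
    open ≤-Reasoning
    ⊆S : K ∪ D ⊆ S
    ⊆S x∈ = [ (λ x∈K → U⊆S (K⊆U x∈K)) , (λ x∈D → D⊆S x∈D) ]′ (x∈p∪q⁻ K D x∈)
    pw : Pairwise (K ∪ D)
    pw u v u∈ v∈ u≢v with x∈p∪q⁻ K D u∈ | x∈p∪q⁻ K D v∈
    ... | inj₁ uK | inj₁ vK = pwK u v uK vK u≢v
    ... | inj₁ uK | inj₂ vD = U~D (K⊆U uK) vD
    ... | inj₂ uD | inj₁ vK = ~-sym (U~D (K⊆U vK) uD)
    ... | inj₂ uD | inj₂ vD = pwD u v uD vD u≢v

  -- Colourings and perfection

  -- Colourings are total functions into `ℕ` with a bound imposed on `S` only, so that they can be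
  -- restricted, shifted and pasted together without carrying membership proofs or casts between
  -- `Fin` types.
  ProperOn : Subset n → ℕ → (Fin n → ℕ) → Set
  ProperOn S k c = (∀ {v} → v ∈ S → c v < k) ×
                   (∀ {u v} → u ∈ S → v ∈ S → u ~ v → c u ≢ c v)

  ColourableOn : Subset n → ℕ → Set
  ColourableOn S k = ∃ (ProperOn S k)

  colourableOn-mono : ∀ {S k l} → k ≤ l → ColourableOn S k → ColourableOn S l
  colourableOn-mono k≤l (c , c<k , proper) = c , (λ v∈S → <-≤-trans (c<k v∈S) k≤l) , proper

  toColourable : ∀ {S k} → ColourableOn S k → Colourable (G [ S ]) k
  toColourable (c , c<k , proper) =
    (λ (v , v∈S) → fromℕ< (c<k v∈S)) ,
    λ (u , u∈S) (v , v∈S) uv eq → proper u∈S v∈S uv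
      (trans (sym (toℕ-fromℕ< (c<k u∈S))) (trans (cong toℕ eq) (toℕ-fromℕ< (c<k v∈S))))

  fromColourable : ∀ {S k} → Colourable (G [ S ]) k → ColourableOn S k
  fromColourable {S} {k} (c , proper) = f , bound , proper′
    where
    f : Fin n → ℕ
    f v with v ∈? S
    ... | yes v∈S = toℕ (c (v , v∈S))
    ... | no _    = 0
    -- The membership proof is existential because `v ∈? S` may return a proof other than the given
    -- one, and `c` may depend on it.
    f-spec : ∀ {v} → v ∈ S → ∃[ v∈S ] f v ≡ toℕ (c (v , v∈S))
    f-spec {v} v∈S with v ∈? S
    ... | yes p = p , refl
    ... | no ¬p = ⊥-elim (¬p v∈S)
    bound : ∀ {v} → v ∈ S → f v < k
    bound {v} v∈S with p , eq ← f-spec v∈S = subst (_< k) (sym eq) (toℕ<n (c (v , p)))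
    proper′ : ∀ {u v} → u ∈ S → v ∈ S → u ~ v → f u ≢ f v
    proper′ u∈S v∈S uv eq with p , eqᵘ ← f-spec u∈S | q , eqᵛ ← f-spec v∈S =
      proper (_ , p) (_ , q) uv (toℕ-injective (trans (sym eqᵘ) (trans eq eqᵛ)))

  -- Pigeonhole: a proper colouring is injective on a clique.
  clique≤colours : ∀ {S K k} → K ⊆ S → Pairwise K → ColourableOn S k → ∣ K ∣ ≤ k
  clique≤colours {S} {K} {k} K⊆S pw (c , c<k , proper) = injective⇒≤ {f = g} g-injective
    where
    e∈S : ∀ i → element K i ∈ S
    e∈S i = K⊆S (element-∈ K i)
    g : Fin ∣ K ∣ → Fin k
    g i = fromℕ< (c<k (e∈S i))
    g-injective : ∀ {i j} → g i ≡ g j → i ≡ j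
    g-injective {i} {j} eq with element K i ≟ᶠ element K j
    ... | yes e = element-injective K e
    ... | no ¬e = ⊥-elim (proper (e∈S i) (e∈S j)
      (pw _ _ (element-∈ K i) (element-∈ K j) ¬e)
      (trans (sym (toℕ-fromℕ< (c<k (e∈S i)))) (trans (cong toℕ eq) (toℕ-fromℕ< (c<k (e∈S j))))))

  -- Only the inequality `χ ≤ ω` is recorded; the reverse one holds in every graph by
  -- `clique≤colours`.
  PerfectOn : Subset n → Set
  PerfectOn X = ∀ S → S ⊆ X → ColourableOn S ω[ S ]

  fromPerfect : ∀ {X} → Perfect (G [ X ]) → PerfectOn X
  fromPerfect perf S S⊆X =
    fromColourable (subst (Colourable (G [ S ])) (perf S S⊆X) (proj₁ (χ-spec (G [ S ]))))

  toPerfect : ∀ {X} → PerfectOn X → Perfect (G [ X ])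
  toPerfect perf S S⊆X with col , low ← χ-spec (G [ S ]) | K , K⊆S , pw , eq ← maximumClique S =
    ≤-antisym (low _ (toColourable (perf S S⊆X)))
              (subst (_≤ χ (G [ S ])) eq (clique≤colours K⊆S pw (fromColourable col)))

  edgeless⇒perfect : ∀ {X} → (∀ {u v} → u ∈ X → v ∈ X → ¬ (u ~ v)) → PerfectOn X
  edgeless⇒perfect noEdge S S⊆X =
    -- `ω-nonempty` is read as `0 < ω[ S ]`. The bound is asked for at vertices of `S` only, so an
    -- empty `S` causes no trouble.
    (λ _ → 0) , ω-nonempty , λ u∈S v∈S uv _ → noEdge (S⊆X u∈S) (S⊆X v∈S) uv

  -- Colour the part of `S` outside `D` with `ω[ S ─ D ]` colours and give each vertex of `S ∩ D` a
  -- fresh colour of its own. By `ω-join` the total is at most `ω[ S ]`.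
  perfect-join : ∀ {X D} → Pairwise D → CompleteTo X D → PerfectOn X → PerfectOn (X ∪ D)
  perfect-join {X} {D} pwD X~D perf S S⊆ = colourableOn-mono ω≤ (c , bound , proper)
    where
    S₁ S₂ : Subset n
    S₁ = S ─ D
    S₂ = S ∩ D
    k : ℕ
    k = ω[ S₁ ]
    S₁⊆X : S₁ ⊆ X
    S₁⊆X x∈ with x∈p∪q⁻ X D (S⊆ (p─q⊆p S D x∈))
    ... | inj₁ x∈X = x∈X
    ... | inj₂ x∈D = ⊥-elim (x∈p─q⇒x∉q S D x∈ x∈D)
    ω≤ : k + ∣ S₂ ∣ ≤ ω[ S ]
    ω≤ = ω-join (λ u v u∈ v∈ → pwD u v (p∩q⊆q S D u∈) (p∩q⊆q S D v∈))
                (λ u∈ d∈ → X~D (S₁⊆X u∈) (p∩q⊆q S D d∈)) (p─q⊆p S D) (p∩q⊆p S D)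
    col : ColourableOn S₁ k
    col = perf S₁ S₁⊆X
    c : Fin n → ℕ
    c v with v ∈? D
    ... | yes _ = k + rank S₂ v
    ... | no _  = proj₁ col v
    bound : ∀ {v} → v ∈ S → c v < k + ∣ S₂ ∣
    bound {v} v∈S with v ∈? D
    ... | yes v∈D = +-monoʳ-< k (rank<∣p∣ S₂ (x∈p∩q⁺ (v∈S , v∈D)))
    ... | no v∉D  = <-≤-trans (proj₁ (proj₂ col) (x∈p∧x∉q⇒x∈p─q v∈S v∉D)) (m≤m+n k ∣ S₂ ∣)
    low : ∀ {v} → v ∈ S → v ∉ D → ∀ {m} → proj₁ col v ≢ k + m
    low v∈S v∉D {m} eq = <-irrefl eq
      (<-≤-trans (proj₁ (proj₂ col) (x∈p∧x∉q⇒x∈p─q v∈S v∉D)) (m≤m+n k m))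
    proper : ∀ {u v} → u ∈ S → v ∈ S → u ~ v → c u ≢ c v
    proper {u} {v} u∈S v∈S uv eq with u ∈? D | v ∈? D
    ... | yes uD | yes vD = ~-irrefl uv
      (rank-injective S₂ (x∈p∩q⁺ (u∈S , uD)) (x∈p∩q⁺ (v∈S , vD)) (+-cancelˡ-≡ k _ _ eq))
    ... | yes uD | no ¬vD = low v∈S ¬vD (sym eq)
    ... | no ¬uD | yes vD = low u∈S ¬uD eq
    ... | no ¬uD | no ¬vD =
      proj₂ (proj₂ col) (x∈p∧x∉q⇒x∈p─q u∈S ¬uD) (x∈p∧x∉q⇒x∈p─q v∈S ¬vD) uv eq

  -- Transposing colours makes c agree with d at one more vertex, and leaves
  -- untouched the vertices of the clique Q at which they agree already.
  align : ∀ {S Q k c d} → Q ⊆ S → Pairwise Q → ProperOn S k c → ProperOn Q k d →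
          ∃[ c′ ] (ProperOn S k c′ × (∀ {q} → q ∈ Q → c′ q ≡ d q))
  align {S} {Q} {k} {c} {d} Q⊆S pw c-proper (d<k , d-proper) =
    let c′ , c′-proper , agree = go (allFin n)
    in  c′ , c′-proper , λ {q} q∈Q → agree (∈-allFin q) q∈Q
    where
    go : (qs : List (Fin n)) →
         ∃[ c′ ] (ProperOn S k c′ × (∀ {q} → q ∈ˡ qs → q ∈ Q → c′ q ≡ d q))
    go []       = c , c-proper , λ ()
    go (q ∷ qs) with c′ , (c′<k , c′-proper) , agree ← go qs | q ∈? Q
    ... | no q∉Q  = c′ , (c′<k , c′-proper) ,
      λ { (here refl) q∈Q → ⊥-elim (q∉Q q∈Q) ; (there r∈) r∈Q → agree r∈ r∈Q }
    ... | yes q∈Q = σ ∘ c′ ,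
      ((λ v∈S → swap-< (c′<k (Q⊆S q∈Q)) (d<k q∈Q) (c′<k v∈S)) ,
       (λ u∈S v∈S uv eq → c′-proper u∈S v∈S uv (swap-injective (c′ q) (d q) eq))) ,
      λ { (here refl) _ → swap-left (c′ q) (d q) ; (there r∈) r∈Q → agree′ r∈ r∈Q }
      where
      σ : ℕ → ℕ
      σ = swap (c′ q) (d q)
      agree′ : ∀ {r} → r ∈ˡ qs → r ∈ Q → σ (c′ r) ≡ d r
      agree′ {r} r∈ r∈Q with r ≟ᶠ q
      ... | yes refl = swap-left (c′ q) (d q)
      -- `c′ r` is neither of the transposed colours: `c′` separates the adjacent vertices `r` and
      -- `q`, and `c′ r` equals `d r`, which differs from `d q` since `d` is proper on `Q`.
      ... | no r≢q   = trans
        (swap-other (c′ q) (d q) (c′-proper (Q⊆S r∈Q) (Q⊆S q∈Q) r~q)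
          (λ eq → d-proper r∈Q q∈Q r~q (trans (sym (agree r∈ r∈Q)) eq)))
        (agree r∈ r∈Q)
        where
        r~q : r ~ q
        r~q = pw r q r∈Q q∈Q r≢q

  -- Colour `S ∩ P` and `S ∩ Q` with `ω[ S ]` colours each, permute the second colouring so that it
  -- agrees with the first on the common clique, and take the union. Every edge lies within `P` or
  -- within `Q`, so the union is proper.
  perfect-glue : ∀ {P Q} → Pairwise (P ∩ Q) →
                 (∀ {x y} → x ∈ P → x ∉ Q → y ∈ Q → y ∉ P → ¬ (x ~ y)) →
                 PerfectOn P → PerfectOn Q → PerfectOn (P ∪ Q)
  perfect-glue {P} {Q} pw noEdge perfP perfQ S S⊆ = glued
    where
    S₁ S₂ R : Subset n
    S₁ = S ∩ P
    S₂ = S ∩ Q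
    R  = S₁ ∩ S₂
    k : ℕ
    k = ω[ S ]
    col₁ : ColourableOn S₁ k
    col₁ = colourableOn-mono (ω-mono (p∩q⊆p S P)) (perfP S₁ (p∩q⊆q S P))
    col₂ : ColourableOn S₂ k
    col₂ = colourableOn-mono (ω-mono (p∩q⊆p S Q)) (perfQ S₂ (p∩q⊆q S Q))
    R⊆P∩Q : R ⊆ P ∩ Q
    R⊆P∩Q x∈ = x∈p∩q⁺ (p∩q⊆q S P (p∩q⊆p S₁ S₂ x∈) , p∩q⊆q S Q (p∩q⊆q S₁ S₂ x∈))
    glued : ColourableOn S k
    glued
      with c₁ , c₁<k , proper₁ ← col₁
      with c₂ , (c₂<k , proper₂) , agree ←
             align {c = proj₁ col₂} {d = c₁} (p∩q⊆q S₁ S₂)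
               (λ u v u∈ v∈ → pw u v (R⊆P∩Q u∈) (R⊆P∩Q v∈)) (proj₂ col₂)
               ((λ v∈ → c₁<k (p∩q⊆p S₁ S₂ v∈)) ,
                (λ u∈ v∈ → proper₁ (p∩q⊆p S₁ S₂ u∈) (p∩q⊆p S₁ S₂ v∈)))
      = c , bound , proper
      where
      c : Fin n → ℕ
      c v with v ∈? P
      ... | yes _ = c₁ v
      ... | no _  = c₂ v
      c≡c₁ : ∀ {v} → v ∈ P → c v ≡ c₁ v
      c≡c₁ {v} v∈P with v ∈? P
      ... | yes _  = refl
      ... | no v∉P = ⊥-elim (v∉P v∈P)
      c≡c₂ : ∀ {v} → v ∈ S → v ∈ Q → c v ≡ c₂ v
      c≡c₂ {v} v∈S v∈Q with v ∈? P
      ... | yes v∈P = sym (agree (x∈p∩q⁺ (x∈p∩q⁺ (v∈S , v∈P) , x∈p∩q⁺ (v∈S , v∈Q))))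
      ... | no _    = refl
      inQ : ∀ {v} → v ∈ S → v ∉ P → v ∈ Q
      inQ v∈S v∉P with x∈p∪q⁻ P Q (S⊆ v∈S)
      ... | inj₁ v∈P = ⊥-elim (v∉P v∈P)
      ... | inj₂ v∈Q = v∈Q
      bound : ∀ {v} → v ∈ S → c v < k
      bound {v} v∈S with x∈p∪q⁻ P Q (S⊆ v∈S)
      ... | inj₁ v∈P = subst (_< k) (sym (c≡c₁ v∈P)) (c₁<k (x∈p∩q⁺ (v∈S , v∈P)))
      ... | inj₂ v∈Q = subst (_< k) (sym (c≡c₂ v∈S v∈Q)) (c₂<k (x∈p∩q⁺ (v∈S , v∈Q)))
      properP : ∀ {u v} → u ∈ S → v ∈ S → u ∈ P → v ∈ P → u ~ v → c u ≢ c v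
      properP u∈S v∈S u∈P v∈P uv eq =
        proper₁ (x∈p∩q⁺ (u∈S , u∈P)) (x∈p∩q⁺ (v∈S , v∈P)) uv
          (trans (sym (c≡c₁ u∈P)) (trans eq (c≡c₁ v∈P)))
      properQ : ∀ {u v} → u ∈ S → v ∈ S → u ∈ Q → v ∈ Q → u ~ v → c u ≢ c v
      properQ u∈S v∈S u∈Q v∈Q uv eq =
        proper₂ (x∈p∩q⁺ (u∈S , u∈Q)) (x∈p∩q⁺ (v∈S , v∈Q)) uv
          (trans (sym (c≡c₂ u∈S u∈Q)) (trans eq (c≡c₂ v∈S v∈Q)))
      sameSide : ∀ {u v} → u ∈ S → v ∈ S → u ~ v → u ∈ P × v ∈ P ⊎ u ∈ Q × v ∈ Q
      sameSide {u} {v} u∈S v∈S uv with u ∈? P | v ∈? P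
      ... | yes uP | yes vP = inj₁ (uP , vP)
      ... | no ¬uP | no ¬vP = inj₂ (inQ u∈S ¬uP , inQ v∈S ¬vP)
      ... | yes uP | no ¬vP with u ∈? Q
      ...   | yes uQ = inj₂ (uQ , inQ v∈S ¬vP)
      ...   | no ¬uQ = ⊥-elim (noEdge uP ¬uQ (inQ v∈S ¬vP) ¬vP uv)
      sameSide {u} {v} u∈S v∈S uv | no ¬uP | yes vP with v ∈? Q
      ...   | yes vQ = inj₂ (inQ u∈S ¬uP , vQ)
      ...   | no ¬vQ = ⊥-elim (noEdge vP ¬vQ (inQ u∈S ¬uP) ¬uP (~-sym uv))
      proper : ∀ {u v} → u ∈ S → v ∈ S → u ~ v → c u ≢ c v
      proper u∈S v∈S uv with sameSide u∈S v∈S uv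
      ... | inj₁ (uP , vP) = properP u∈S v∈S uP vP uv
      ... | inj₂ (uQ , vQ) = properQ u∈S v∈S uQ vQ uv

  perfect-⊆ : ∀ {X Y} → X ⊆ Y → PerfectOn Y → PerfectOn X
  perfect-⊆ X⊆Y perf S S⊆X = perf S (λ x∈S → X⊆Y (S⊆X x∈S))

  -- Good partitions

  -- A good partition of `G [ S ]` in elementwise form, with perfection expressed by colourings, so
  -- that parts can be recombined by membership arguments alone.
  record Division (S : Subset n) : Set where
    field
      X Y      : Subset n
      X⊆S      : X ⊆ S
      Y⊆S      : Y ⊆ S
      cover    : ∀ {x} → x ∈ S → x ∈ X ⊎ x ∈ Y
      disjoint : ∀ {x} → x ∈ X → x ∉ Y
      perfect  : PerfectOn X
      ω-drop   : ω[ Y ] < ω[ S ]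

  toDivision : ∀ {S A B} → IsGoodPartition (G [ S ]) A B → Division S
  toDivision {S} {A} {B} ((A∪B≡S , A∩B≡⊥) , perf , drop) = record
    { X        = A
    ; Y        = B
    ; X⊆S      = λ x∈A → subst (_ ∈_) A∪B≡S (p⊆p∪q B x∈A)
    ; Y⊆S      = λ x∈B → subst (_ ∈_) A∪B≡S (q⊆p∪q A B x∈B)
    ; cover    = λ x∈S → x∈p∪q⁻ A B (subst (_ ∈_) (sym A∪B≡S) x∈S)
    ; disjoint = λ x∈A x∈B → ∉⊥ (subst (_ ∈_) A∩B≡⊥ (x∈p∩q⁺ (x∈A , x∈B)))
    ; perfect  = fromPerfect perf
    ; ω-drop   = drop
    }

  fromDivision : ∀ {S} → Division S → ∃[ A ] ∃[ B ] IsGoodPartition (G [ S ]) A B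
  fromDivision div = X , Y ,
    (⊆-antisym (λ x∈ → [ (λ x∈X → X⊆S x∈X) , (λ x∈Y → Y⊆S x∈Y) ]′ (x∈p∪q⁻ X Y x∈))
               (λ x∈S → x∈p∪q⁺ (cover x∈S)) ,
     Empty-unique λ (x , x∈) → disjoint (p∩q⊆p X Y x∈) (p∩q⊆q X Y x∈)) ,
    toPerfect perfect , ω-drop
    where open Division div

  -- `PerfectlyDivisible` says nothing about edgeless graphs, yet the two pieces of a separation may
  -- be edgeless. Everything then goes into the perfect part, and the vertex `x` makes `ω[ S ]`
  -- positive.
  edgelessDivision : ∀ {S x} → x ∈ S → (∀ {u v} → u ∈ S → v ∈ S → ¬ (u ~ v)) → Division S
  edgelessDivision {S} x∈S noEdge = record
    { X        = S
    ; Y        = ⊥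
    ; X⊆S      = λ x∈ → x∈
    ; Y⊆S      = λ x∈ → ⊥-elim (∉⊥ x∈)
    ; cover    = inj₁
    ; disjoint = λ _ → ∉⊥
    ; perfect  = edgeless⇒perfect noEdge
    ; ω-drop   = subst (_< ω[ S ]) (sym ω-⊥) (ω-nonempty x∈S)
    }

  perfectlyDivisible⇒division : ∀ {S x} → x ∈ S → PerfectlyDivisible (G [ S ]) → Division S
  perfectlyDivisible⇒division {S} x∈S pd
    with any? (λ u → any? λ v → u ∈? S ×-dec v ∈? S ×-dec u ~? v)
  ... | yes (u , v , u∈S , v∈S , uv)
    with A , B , good ← pd S (λ y∈S → y∈S) ((u , u∈S) , (v , v∈S) , uv) = toDivision good
  ... | no noEdge =
    edgelessDivision x∈S (λ u∈S v∈S uv → noEdge (_ , _ , u∈S , v∈S , uv))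

  -- Passing from `U` to `S` gains at least `∣ D ∣` in clique number, while `D` contributes at most
  -- `∣ D ∣` vertices to `K`; the strict drop from `U` to `Y` therefore survives.
  clique-in-join : ∀ {U D S K} (div : Division U) → Pairwise D → CompleteTo U D →
                   U ⊆ S → D ⊆ S → Pairwise K → K ⊆ Division.Y div ∪ D → ∣ K ∣ < ω[ S ]
  clique-in-join {U} {D} {S} {K} div pwD U~D U⊆S D⊆S pwK K⊆ = begin-strict
    ∣ K ∣                        ≡⟨ ∣p∣≡∣p∩q∣+∣p─q∣ K D ⟩
    ∣ K ∩ D ∣ + ∣ K ─ D ∣        ≤⟨ +-mono-≤ (p⊆q⇒∣p∣≤∣q∣ (p∩q⊆q K D)) (clique≤ω ⊆Y pw) ⟩
    ∣ D ∣ + ω[ Y ]               <⟨ +-monoʳ-< ∣ D ∣ ω-drop ⟩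
    ∣ D ∣ + ω[ U ]               ≡⟨ +-comm ∣ D ∣ ω[ U ] ⟩
    ω[ U ] + ∣ D ∣               ≤⟨ ω-join pwD U~D U⊆S D⊆S ⟩
    ω[ S ]                       ∎
    where
    open ≤-Reasoning
    open Division div
    ⊆Y : K ─ D ⊆ Y
    ⊆Y x∈ with x∈p∪q⁻ Y D (K⊆ (p─q⊆p K D x∈))
    ... | inj₁ x∈Y = x∈Y
    ... | inj₂ x∈D = ⊥-elim (x∈p─q⇒x∉q K D x∈ x∈D)
    pw : Pairwise (K ─ D)
    pw u v u∈ v∈ = pwK u v (p─q⊆p K D u∈) (p─q⊆p K D v∈)

  -- Separations

  -- `A` and `B` are unions of components of `G - C`, not necessarily single components. This leaves
  -- freedom to move vertices to the other side when `C` shrinks.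
  record Separation (A B C : Subset n) : Set where
    field
      A≠∅    : Nonempty A
      B≠∅    : Nonempty B
      A⊆V    : A ⊆ V G
      B⊆V    : B ⊆ V G
      C⊆V    : C ⊆ V G
      cover  : ∀ {x} → x ∈ V G → x ∈ A ⊎ x ∈ B ⊎ x ∈ C
      A∩B    : ∀ {x} → x ∈ A → x ∉ B
      A∩C    : ∀ {x} → x ∈ A → x ∉ C
      B∩C    : ∀ {x} → x ∈ B → x ∉ C
      anti   : ∀ {a b} → a ∈ A → b ∈ B → ¬ (a ~ b)
      clique : Pairwise C

  flip : ∀ {A B C} → Separation A B C → Separation B A C
  flip sep = record
    { A≠∅    = B≠∅
    ; B≠∅    = A≠∅
    ; A⊆V    = B⊆V
    ; B⊆V    = A⊆V
    ; C⊆V    = C⊆V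
    ; cover  = λ x∈V → [ (λ a → inj₂ (inj₁ a)) , [ inj₁ , (λ c → inj₂ (inj₂ c)) ]′ ]′ (cover x∈V)
    ; A∩B    = λ x∈B x∈A → A∩B x∈A x∈B
    ; A∩C    = B∩C
    ; B∩C    = A∩C
    ; anti   = λ b∈B a∈A ba → anti a∈A b∈B (~-sym ba)
    ; clique = clique
    }
    where open Separation sep

  Splits : Subset n → Set
  Splits C = ∃[ A ] ∃[ B ] Separation A B C

  MixedEdge : Fin n → Subset n → Set
  MixedEdge c A = ∃[ x ] ∃[ y ] (x ∈ A × y ∈ A × c ~ x × ¬ (c ~ y) × x ~ y)

  mixedEdge? : ∀ c A → Dec (MixedEdge c A)
  mixedEdge? c A = any? λ x → any? λ y →
    x ∈? A ×-dec y ∈? A ×-dec c ~? x ×-dec ¬? (c ~? y) ×-dec x ~? y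

  -- The new first side consists of the non-neighbours of `c` in `A`. An edge from it to the rest of
  -- `A` would be mixed, and it has no edge to `B` or to `c`. Hence `c` can leave the cutset and
  -- join the other side with `B` and its own neighbours in `A`.
  shrink : ∀ {A B C c a} → Separation A B C → c ∈ C → a ∈ A → ¬ (c ~ a) →
           ¬ MixedEdge c A → Splits (C - c)
  shrink {A} {B} {C} {c} {a} sep c∈C a∈A c≁a noMixed = A′ , B′ , record
    { A≠∅    = a , ∈-comprehension⁺ inA′? (a∈A , c≁a)
    -- The witness is `c` itself, which lies outside `A` and has just been removed from the cutset.
    ; B≠∅    = c , ∈-comprehension⁺ inB′?
        (C⊆V c∈C , (λ c∈ → A∩C (proj₁ (A′⁻ c∈)) c∈C) , λ c∈ → x∈p─q⇒x∉q C ⁅ c ⁆ c∈ (x∈⁅x⁆ c))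
    ; A⊆V    = λ x∈ → A⊆V (proj₁ (A′⁻ x∈))
    ; B⊆V    = λ x∈ → proj₁ (B′⁻ x∈)
    ; C⊆V    = λ x∈ → C⊆V (p─q⊆p C ⁅ c ⁆ x∈)
    ; cover  = cover′
    ; A∩B    = λ x∈A x∈B → proj₁ (proj₂ (B′⁻ x∈B)) x∈A
    ; A∩C    = λ x∈A x∈C → A∩C (proj₁ (A′⁻ x∈A)) (p─q⊆p C ⁅ c ⁆ x∈C)
    ; B∩C    = λ x∈B → proj₂ (proj₂ (B′⁻ x∈B))
    ; anti   = anti′
    ; clique = λ u v u∈ v∈ → clique u v (p─q⊆p C ⁅ c ⁆ u∈) (p─q⊆p C ⁅ c ⁆ v∈)
    }
    where
    open Separation sep
    inA′? : ∀ x → Dec (x ∈ A × ¬ (c ~ x))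
    inA′? x = x ∈? A ×-dec ¬? (c ~? x)
    A′ : Subset n
    A′ = comprehension inA′?
    inB′? : ∀ x → Dec (x ∈ V G × x ∉ A′ × x ∉ C - c)
    inB′? x = x ∈? V G ×-dec ¬? (x ∈? A′) ×-dec ¬? (x ∈? (C - c))
    B′ : Subset n
    B′ = comprehension inB′?
    A′⁻ : ∀ {x} → x ∈ A′ → x ∈ A × ¬ (c ~ x)
    A′⁻ = ∈-comprehension⁻ inA′?
    B′⁻ : ∀ {x} → x ∈ B′ → x ∈ V G × x ∉ A′ × x ∉ C - c
    B′⁻ = ∈-comprehension⁻ inB′?
    cover′ : ∀ {x} → x ∈ V G → x ∈ A′ ⊎ x ∈ B′ ⊎ x ∈ C - c
    cover′ {x} x∈V with x ∈? A′ | x ∈? (C - c)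
    ... | yes p | _     = inj₁ p
    ... | no _  | yes q = inj₂ (inj₂ q)
    ... | no ¬p | no ¬q = inj₂ (inj₁ (∈-comprehension⁺ inB′? (x∈V , ¬p , ¬q)))
    anti′ : ∀ {x y} → x ∈ A′ → y ∈ B′ → ¬ (x ~ y)
    anti′ {x} {y} x∈ y∈ xy with A′⁻ x∈ | B′⁻ y∈
    ... | x∈A , c≁x | y∈V , y∉A′ , y∉C′ with cover y∈V | y ≟ᶠ c | c ~? y
    ...   | inj₁ y∈A        | _        | yes cy = noMixed (y , x , y∈A , x∈A , cy , c≁x , ~-sym xy)
    ...   | inj₁ y∈A        | _        | no c≁y = y∉A′ (∈-comprehension⁺ inA′? (y∈A , c≁y))
    ...   | inj₂ (inj₁ y∈B) | _        | _      = anti x∈A y∈B xy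
    ...   | inj₂ (inj₂ y∈C) | yes refl | _      = c≁x (~-sym xy)
    ...   | inj₂ (inj₂ y∈C) | no y≢c   | _      = y∉C′ (x∈p∧x≢y⇒x∈p-y y∈C y≢c)

  -- One side is the component of `u` in `G - C`, the other is the rest, which contains `v`. The
  -- component is built by adding neighbours to `⁅ u ⁆` until the set is closed; this stops because
  -- a subset of `Fin n` cannot grow forever.
  cutset⇒splits : ∀ {C} → IsCliqueCutset G C → Splits C
  cutset⇒splits {C} ((C⊆V , clique) , (u , u∈W) , (v , v∈W) , ¬u⇝v) =
    build (grow ⁅ u ⁆ (⊃-wellFounded _) (x∈⁅x⁆ u)
      λ x∈ → subst (λ y → Reach y) (sym (x∈⁅y⁆⇒x≡y u x∈)) (u∈W , ε))
    where
    W : Subset n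
    W = V G ─ C
    Reach : Fin n → Set
    Reach x = Σ (x ∈ W) λ x∈W → Star (Adj (G [ W ])) (u , u∈W) (x , x∈W)
    Component : Subset n → Set
    Component R = u ∈ R × (∀ {x} → x ∈ R → Reach x) ×
                  (∀ {x y} → x ∈ R → y ∈ W → y ∉ R → ¬ (x ~ y))
    grow : ∀ R → Acc _⊃_ R → u ∈ R → (∀ {x} → x ∈ R → Reach x) → ∃ Component
    grow R (acc rs) u∈R reach
      with any? (λ x → any? λ y → x ∈? R ×-dec y ∈? W ×-dec ¬? (y ∈? R) ×-dec x ~? y)
    ... | no closed = R , u∈R , reach ,
      λ x∈R y∈W y∉R xy → closed (_ , _ , x∈R , y∈W , y∉R , xy)
    ... | yes (x , y , x∈R , y∈W , y∉R , xy) =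
      grow (R ∪ ⁅ y ⁆) (rs (p⊆p∪q ⁅ y ⁆ , y , q⊆p∪q R ⁅ y ⁆ (x∈⁅x⁆ y) , y∉R))
        (p⊆p∪q ⁅ y ⁆ u∈R) reach′
      where
      reach′ : ∀ {z} → z ∈ R ∪ ⁅ y ⁆ → Reach z
      reach′ z∈ with x∈p∪q⁻ R ⁅ y ⁆ z∈
      ... | inj₁ z∈R = reach z∈R
      ... | inj₂ z∈y with refl ← x∈⁅y⁆⇒x≡y y z∈y | x∈W , u⇝x ← reach x∈R =
        y∈W , u⇝x ◅◅ (xy ◅ ε)
    build : ∃ Component → Splits C
    build (R , u∈R , reach , closed) = R , W ─ R , record
      { A≠∅    = u , u∈R
      ; B≠∅    = v , x∈p∧x∉q⇒x∈p─q v∈W v∉R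
      ; A⊆V    = λ x∈R → p─q⊆p (V G) C (R⊆W x∈R)
      ; B⊆V    = λ x∈ → p─q⊆p (V G) C (p─q⊆p W R x∈)
      ; C⊆V    = C⊆V
      ; cover  = cover′
      ; A∩B    = λ x∈R x∈ → x∈p─q⇒x∉q W R x∈ x∈R
      ; A∩C    = λ x∈R → x∈p─q⇒x∉q (V G) C (R⊆W x∈R)
      ; B∩C    = λ x∈ → x∈p─q⇒x∉q (V G) C (p─q⊆p W R x∈)
      ; anti   = λ x∈R y∈ → closed x∈R (p─q⊆p W R y∈) (x∈p─q⇒x∉q W R y∈)
      ; clique = clique
      }
      where
      R⊆W : R ⊆ W
      R⊆W x∈R = proj₁ (reach x∈R)
      v∉R : v ∉ R
      v∉R v∈R with v∈W′ , u⇝v ← reach v∈R =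
        -- Vertices carry membership proofs, so the walk found ends at `v` paired with a possibly
        -- different proof; irrelevance of `_∈_` identifies the two.
        ¬u⇝v (subst (λ p → Star (Adj (G [ W ])) (u , u∈W) (v , p)) ([]=-irrelevant v∈W′ v∈W) u⇝v)
      cover′ : ∀ {x} → x ∈ V G → x ∈ R ⊎ x ∈ W ─ R ⊎ x ∈ C
      cover′ {x} x∈V with x ∈? R | x ∈? C
      ... | yes p | _     = inj₁ p
      ... | no _  | yes q = inj₂ (inj₂ q)
      ... | no ¬p | no ¬q = inj₂ (inj₁ (x∈p∧x∉q⇒x∈p─q (x∈p∧x∉q⇒x∈p─q x∈V ¬q) ¬p))

  -- Induced five-vertex paths

  -- Injectivity of `f` comes for free: distinct vertices of `P₅` have distinct neighbourhoods, and
  -- `f` preserves and reflects adjacency.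
  induced-P₅ : (f : Fin 5 → Fin n) → (∀ i → f i ∈ V G) →
               (∀ i j → adj G (f i) (f j) ≡ adj P₅ i j) → ¬ P₅-free G
  induced-P₅ f f∈V f-adj free = free (S , S⊆V , record
    { bijection = mk↔ₛ′ to from to-from from-to
    ; preserves = λ (x , x∈S) (y , y∈S) →
        mk⇔ (subst T (adj-index x∈S y∈S)) (subst T (sym (adj-index x∈S y∈S)))
    })
    where
    image? : ∀ x → Dec (∃[ i ] f i ≡ x)
    image? x = any? λ i → f i ≟ᶠ x
    S : Subset n
    S = comprehension image?
    index : ∀ {x} → x ∈ S → ∃[ i ] f i ≡ x
    index = ∈-comprehension⁻ image?
    S⊆V : S ⊆ V G
    S⊆V x∈S with i , refl ← index x∈S = f∈V i
    P₅-twin-free : ∀ i j → (∀ k → adj P₅ i k ≡ adj P₅ j k) → i ≡ j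
    -- A finite check, settled by evaluating the decision procedure.
    P₅-twin-free = toWitness
      {a? = all? λ i → all? λ j → (all? λ k → adj P₅ i k Bool.≟ adj P₅ j k) →-dec (i ≟ᶠ j)} _
    f-injective : ∀ {i j} → f i ≡ f j → i ≡ j
    f-injective {i} {j} eq = P₅-twin-free i j λ k →
      trans (sym (f-adj i k)) (trans (cong (λ x → adj G x (f k)) eq) (f-adj j k))
    to : Vertex (G [ S ]) → Vertex P₅
    to (x , x∈S) = proj₁ (index x∈S) , ∈⊤
    from : Vertex P₅ → Vertex (G [ S ])
    from (i , _) = f i , ∈-comprehension⁺ image? (i , refl)
    vertex-≡ : ∀ {m} {p : Subset m} {x y : Fin m} {x∈p : x ∈ p} {y∈p : y ∈ p} →
               x ≡ y → _≡_ {A = Σ (Fin m) (_∈ p)} (x , x∈p) (y , y∈p)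
    vertex-≡ {x = x} refl = cong (x ,_) ([]=-irrelevant _ _)
    to-from : ∀ v → to (from v) ≡ v
    to-from (i , _) = vertex-≡ (f-injective (proj₂ (index (∈-comprehension⁺ image? (i , refl)))))
    from-to : ∀ v → from (to v) ≡ v
    from-to (x , x∈S) = vertex-≡ (proj₂ (index x∈S))
    adj-index : ∀ {x y} (x∈S : x ∈ S) (y∈S : y ∈ S) →
                adj G x y ≡ adj P₅ (proj₁ (index x∈S)) (proj₁ (index y∈S))
    adj-index x∈S y∈S =
      trans (cong₂ (adj G) (sym (proj₂ (index x∈S))) (sym (proj₂ (index y∈S)))) (f-adj _ _)

  mixedEdges⇒P₅ : ∀ {A B C c} → Separation A B C → c ∈ C →
                  MixedEdge c A → MixedEdge c B → ¬ P₅-free G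
  mixedEdges⇒P₅ {c = c} sep c∈C (x₁ , y₁ , x₁∈ , y₁∈ , cx₁ , c≁y₁ , xy₁)
                (x₂ , y₂ , x₂∈ , y₂∈ , cx₂ , c≁y₂ , xy₂) =
    induced-P₅ f f∈V f-adj
    where
    open Separation sep
    f : Fin 5 → Fin n
    -- Each mixed edge is traversed so that its end adjacent to `c` comes next to `c`.
    f = lookup (y₁ ∷ x₁ ∷ c ∷ x₂ ∷ y₂ ∷ [])
    f∈V : ∀ i → f i ∈ V G
    f∈V 0F = A⊆V y₁∈
    f∈V 1F = A⊆V x₁∈
    f∈V 2F = C⊆V c∈C
    f∈V 3F = B⊆V x₂∈
    f∈V 4F = B⊆V y₂∈
    edge : ∀ {u v} → u ~ v → adj G u v ≡ true
    edge {u} {v} = dec-true (u ~? v)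
    nonEdge : ∀ {u v} → ¬ (u ~ v) → adj G u v ≡ false
    nonEdge {u} {v} = dec-false (u ~? v)
    upper : ∀ i j → i <ᶠ j → adj G (f i) (f j) ≡ adj P₅ i j
    upper 0F 1F _ = edge (~-sym xy₁)
    upper 0F 2F _ = nonEdge (λ yc → c≁y₁ (~-sym yc))
    upper 0F 3F _ = nonEdge (anti y₁∈ x₂∈)
    upper 0F 4F _ = nonEdge (anti y₁∈ y₂∈)
    upper 1F 2F _ = edge (~-sym cx₁)
    upper 1F 3F _ = nonEdge (anti x₁∈ x₂∈)
    upper 1F 4F _ = nonEdge (anti x₁∈ y₂∈)
    upper 2F 3F _ = edge cx₂
    upper 2F 4F _ = nonEdge c≁y₂
    upper 3F 4F _ = edge xy₂
    upper _ 0F ()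
    upper (suc _) 1F (s≤s ())
    upper (suc (suc _)) 2F (s≤s (s≤s ()))
    upper (suc (suc (suc _))) 3F (s≤s (s≤s (s≤s ())))
    upper 4F 4F (s≤s (s≤s (s≤s (s≤s ()))))
    f-adj : ∀ i j → adj G (f i) (f j) ≡ adj P₅ i j
    f-adj i j with <-cmp i j
    ... | tri< i<j _ _  = upper i j i<j
    ... | tri≈ _ refl _ = trans (adj-irrefl G (f i)) (sym (adj-irrefl P₅ i))
    ... | tri> _ _ j<i  =
      trans (adj-sym G (f i) (f j)) (trans (upper j i j<i) (adj-sym P₅ j i))

  -- Reduction to bicomplete separations

  Bicomplete : Subset n → Subset n → Subset n → Set
  Bicomplete A B C = ∀ {c} → c ∈ C → (∀ {a} → a ∈ A → c ~ a) ⊎ (∀ {b} → b ∈ B → c ~ b)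

  -- A vertex of `C` with non-neighbours on both sides lacks a mixed edge on one of them, for
  -- otherwise there is a `P₅`; `shrink` then deletes it from `C`. Both sides change at each
  -- deletion, so the recursion follows `C` alone and quantifies over the sides afresh.
  bicompleteSeparation : P₅-free G → ∀ C → Acc _⊂_ C → Splits C →
                         ∃[ A ] ∃[ B ] ∃[ C′ ] (Separation A B C′ × Bicomplete A B C′)
  bicompleteSeparation free C (acc rs) (A , B , sep)
    with any? (λ c → any? λ a → any? λ b →
      c ∈? C ×-dec a ∈? A ×-dec b ∈? B ×-dec ¬? (c ~? a) ×-dec ¬? (c ~? b))
  ... | yes (c , a , b , c∈C , a∈A , b∈B , c≁a , c≁b) with mixedEdge? c A | mixedEdge? c B
  ...   | yes m₁ | yes m₂ = ⊥-elim (mixedEdges⇒P₅ sep c∈C m₁ m₂ free)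
  ...   | no ¬m  | _      = bicompleteSeparation free (C - c) (rs (x∈p⇒p-x⊂p c∈C))
                              (shrink sep c∈C a∈A c≁a ¬m)
  ...   | yes _  | no ¬m  = bicompleteSeparation free (C - c) (rs (x∈p⇒p-x⊂p c∈C))
                              (shrink (flip sep) c∈C b∈B c≁b ¬m)
  bicompleteSeparation free C (acc rs) (A , B , sep) | no none = A , B , C , sep , bicomplete
    where
    bicomplete : Bicomplete A B C
    bicomplete {c} c∈C with any? (λ a → a ∈? A ×-dec ¬? (c ~? a))
    ... | yes (a , a∈A , c≁a) = inj₂ λ {b} b∈B → decidable-stable (c ~? b)
      λ c≁b → none (c , a , b , c∈C , a∈A , b∈B , c≁a , c≁b)
    ... | no complete = inj₁ λ {a} a∈A → decidable-stable (c ~? a)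
      λ c≁a → complete (a , a∈A , c≁a)

  -- Combining divisions across a bicomplete separation

  division-∪ : ∀ {A B C D E} → Separation A B C → D ⊆ C → E ⊆ C →
               (∀ {x} → x ∈ C → x ∈ D ⊎ x ∈ E) → (∀ {x} → x ∈ D → x ∉ E) →
               CompleteTo A D → CompleteTo B E →
               Division (A ∪ E) → Division (B ∪ D) → Division (V G)
  division-∪ {A} {B} {C} {D} {E} sep D⊆C E⊆C C⁻ D∩E A~D B~E div₁ div₂ = record
    { X        = X
    ; Y        = Y
    ; X⊆S      = λ x∈ → [ (λ p → U₁⊆V (X₁.X⊆S p)) , (λ p → U₂⊆V (X₂.X⊆S p)) ]′ (X⁻ x∈)
    ; Y⊆S      = λ x∈ → [ (λ p → U₁⊆V (X₁.Y⊆S p)) , (λ p → U₂⊆V (X₂.Y⊆S p)) ]′ (Y⁻ x∈)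
    ; cover    = cover′
    ; disjoint = disjoint′
    ; perfect  = perfect′
    ; ω-drop   = drop
    }
    where
    open Separation sep
    D⊆V : D ⊆ V G
    D⊆V x∈ = C⊆V (D⊆C x∈)
    E⊆V : E ⊆ V G
    E⊆V x∈ = C⊆V (E⊆C x∈)
    pwD : Pairwise D
    pwD u v u∈ v∈ = clique u v (D⊆C u∈) (D⊆C v∈)
    pwE : Pairwise E
    pwE u v u∈ v∈ = clique u v (E⊆C u∈) (E⊆C v∈)
    E~D : CompleteTo E D
    E~D u∈E d∈D = clique _ _ (E⊆C u∈E) (D⊆C d∈D) λ { refl → D∩E d∈D u∈E }
    U₁~D : CompleteTo (A ∪ E) D
    U₁~D u∈ d∈D = [ (λ u∈A → A~D u∈A d∈D) , (λ u∈E → E~D u∈E d∈D) ]′ (x∈p∪q⁻ A E u∈)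
    U₂~E : CompleteTo (B ∪ D) E
    U₂~E u∈ e∈E = [ (λ u∈B → B~E u∈B e∈E) , (λ u∈D → ~-sym (E~D e∈E u∈D)) ]′ (x∈p∪q⁻ B D u∈)
    U₁⊆V : A ∪ E ⊆ V G
    U₁⊆V x∈ = [ (λ p → A⊆V p) , (λ p → E⊆V p) ]′ (x∈p∪q⁻ A E x∈)
    U₂⊆V : B ∪ D ⊆ V G
    U₂⊆V x∈ = [ (λ p → B⊆V p) , (λ p → D⊆V p) ]′ (x∈p∪q⁻ B D x∈)
    U₁∩U₂ : ∀ {x} → x ∈ A ∪ E → x ∉ B ∪ D
    U₁∩U₂ x∈₁ x∈₂ with x∈p∪q⁻ A E x∈₁ | x∈p∪q⁻ B D x∈₂
    ... | inj₁ x∈A | inj₁ x∈B = A∩B x∈A x∈B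
    ... | inj₁ x∈A | inj₂ x∈D = A∩C x∈A (D⊆C x∈D)
    ... | inj₂ x∈E | inj₁ x∈B = B∩C x∈B (E⊆C x∈E)
    ... | inj₂ x∈E | inj₂ x∈D = D∩E x∈D x∈E
    module X₁ = Division div₁
    module X₂ = Division div₂
    X Y : Subset n
    X = X₁.X ∪ X₂.X
    Y = X₁.Y ∪ X₂.Y
    X⁻ : ∀ {x} → x ∈ X → x ∈ X₁.X ⊎ x ∈ X₂.X
    X⁻ = x∈p∪q⁻ X₁.X X₂.X
    Y⁻ : ∀ {x} → x ∈ Y → x ∈ X₁.Y ⊎ x ∈ X₂.Y
    Y⁻ = x∈p∪q⁻ X₁.Y X₂.Y
    from₁ : ∀ {x} → x ∈ A ∪ E → x ∈ X ⊎ x ∈ Y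
    from₁ x∈ = ⊎-map (p⊆p∪q X₂.X) (p⊆p∪q X₂.Y) (X₁.cover x∈)
    from₂ : ∀ {x} → x ∈ B ∪ D → x ∈ X ⊎ x ∈ Y
    from₂ x∈ = ⊎-map (q⊆p∪q X₁.X X₂.X) (q⊆p∪q X₁.Y X₂.Y) (X₂.cover x∈)
    cover′ : ∀ {x} → x ∈ V G → x ∈ X ⊎ x ∈ Y
    cover′ {x} x∈V with cover x∈V
    ... | inj₁ x∈A        = from₁ (p⊆p∪q E x∈A)
    ... | inj₂ (inj₁ x∈B) = from₂ (p⊆p∪q D x∈B)
    ... | inj₂ (inj₂ x∈C) with C⁻ x∈C
    ...   | inj₁ x∈D = from₂ (q⊆p∪q B D x∈D)
    ...   | inj₂ x∈E = from₁ (q⊆p∪q A E x∈E)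
    disjoint′ : ∀ {x} → x ∈ X → x ∉ Y
    disjoint′ x∈X x∈Y with X⁻ x∈X | Y⁻ x∈Y
    ... | inj₁ p | inj₁ q = X₁.disjoint p q
    ... | inj₁ p | inj₂ q = U₁∩U₂ (X₁.X⊆S p) (X₂.Y⊆S q)
    ... | inj₂ p | inj₁ q = U₁∩U₂ (X₁.Y⊆S q) (X₂.X⊆S p)
    ... | inj₂ p | inj₂ q = X₂.disjoint p q

    -- Each of `X₁.X` and `X₂.X` is enlarged by the vertices of `C` chosen on the other side, which
    -- are complete to it. Then `P` and `Q` overlap within the clique `C`, while `P` outside `Q`
    -- lies in `A` and `Q` outside `P` lies in `B`, as `perfect-glue` demands.
    P Q : Subset n
    P = X₁.X ∪ (X₂.X ∩ D)
    Q = X₂.X ∪ (X₁.X ∩ E)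
    P⁻ : ∀ {x} → x ∈ P → x ∈ A ⊎ x ∈ C × x ∈ Q
    P⁻ x∈ with x∈p∪q⁻ X₁.X (X₂.X ∩ D) x∈
    ... | inj₂ x∈₂ = inj₂ (D⊆C (p∩q⊆q X₂.X D x∈₂) , p⊆p∪q (X₁.X ∩ E) (p∩q⊆p X₂.X D x∈₂))
    ... | inj₁ x∈₁ with x∈p∪q⁻ A E (X₁.X⊆S x∈₁)
    ...   | inj₁ x∈A = inj₁ x∈A
    ...   | inj₂ x∈E = inj₂ (E⊆C x∈E , q⊆p∪q X₂.X (X₁.X ∩ E) (x∈p∩q⁺ (x∈₁ , x∈E)))
    Q⁻ : ∀ {x} → x ∈ Q → x ∈ B ⊎ x ∈ C × x ∈ P
    Q⁻ x∈ with x∈p∪q⁻ X₂.X (X₁.X ∩ E) x∈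
    ... | inj₂ x∈₁ = inj₂ (E⊆C (p∩q⊆q X₁.X E x∈₁) , p⊆p∪q (X₂.X ∩ D) (p∩q⊆p X₁.X E x∈₁))
    ... | inj₁ x∈₂ with x∈p∪q⁻ B D (X₂.X⊆S x∈₂)
    ...   | inj₁ x∈B = inj₁ x∈B
    ...   | inj₂ x∈D = inj₂ (D⊆C x∈D , q⊆p∪q X₁.X (X₂.X ∩ D) (x∈p∩q⁺ (x∈₂ , x∈D)))
    P∩Q⊆C : P ∩ Q ⊆ C
    P∩Q⊆C x∈ with P⁻ (p∩q⊆p P Q x∈) | Q⁻ (p∩q⊆q P Q x∈)
    ... | inj₂ (x∈C , _) | _              = x∈C
    ... | inj₁ _         | inj₂ (x∈C , _) = x∈C
    ... | inj₁ x∈A       | inj₁ x∈B       = ⊥-elim (A∩B x∈A x∈B)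
    noEdge : ∀ {x y} → x ∈ P → x ∉ Q → y ∈ Q → y ∉ P → ¬ (x ~ y)
    noEdge x∈P x∉Q y∈Q y∉P xy with P⁻ x∈P | Q⁻ y∈Q
    ... | inj₂ (_ , x∈Q) | _              = x∉Q x∈Q
    ... | inj₁ _         | inj₂ (_ , y∈P) = y∉P y∈P
    ... | inj₁ x∈A       | inj₁ y∈B       = anti x∈A y∈B xy
    perfectP : PerfectOn P
    perfectP = perfect-join
      (λ u v u∈ v∈ → pwD u v (p∩q⊆q X₂.X D u∈) (p∩q⊆q X₂.X D v∈))
      (λ u∈ d∈ → U₁~D (X₁.X⊆S u∈) (p∩q⊆q X₂.X D d∈)) X₁.perfect
    perfectQ : PerfectOn Q
    perfectQ = perfect-join
      (λ u v u∈ v∈ → pwE u v (p∩q⊆q X₁.X E u∈) (p∩q⊆q X₁.X E v∈))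
      (λ u∈ e∈ → U₂~E (X₂.X⊆S u∈) (p∩q⊆q X₁.X E e∈)) X₂.perfect
    perfect′ : PerfectOn X
    perfect′ = perfect-⊆
      (λ x∈ → x∈p∪q⁺ (⊎-map (p⊆p∪q (X₂.X ∩ D)) (p⊆p∪q (X₁.X ∩ E)) (X⁻ x∈)))
      (perfect-glue (λ u v u∈ v∈ → clique u v (P∩Q⊆C u∈) (P∩Q⊆C v∈)) noEdge perfectP perfectQ)

    drop : ω[ Y ] < ω[ V G ]
    -- A clique cannot meet both `A` and `B`. If `K` misses `B`, its vertices from `X₂.Y` lie in
    -- `D`; if it meets `B`, it misses `A`, and its vertices from `X₁.Y` lie in `E`.
    drop with K , K⊆Y , pwK , eq ← maximumClique Y with any? (λ x → x ∈? K ×-dec x ∈? B)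
    ... | no K∩B≡∅ = subst (_< ω[ V G ]) eq
      (clique-in-join div₁ pwD U₁~D U₁⊆V D⊆V pwK K⊆)
      where
      K⊆ : K ⊆ X₁.Y ∪ D
      K⊆ x∈K with Y⁻ (K⊆Y x∈K)
      ... | inj₁ x∈₁ = p⊆p∪q D x∈₁
      ... | inj₂ x∈₂ with x∈p∪q⁻ B D (X₂.Y⊆S x∈₂)
      ...   | inj₁ x∈B = ⊥-elim (K∩B≡∅ (_ , x∈K , x∈B))
      ...   | inj₂ x∈D = q⊆p∪q X₁.Y D x∈D
    ... | yes (b , b∈K , b∈B) = subst (_< ω[ V G ]) eq
      (clique-in-join div₂ pwE U₂~E U₂⊆V E⊆V pwK K⊆)
      where
      K⊆ : K ⊆ X₂.Y ∪ E
      K⊆ x∈K with Y⁻ (K⊆Y x∈K)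
      ... | inj₂ x∈₂ = p⊆p∪q E x∈₂
      ... | inj₁ x∈₁ with x∈p∪q⁻ A E (X₁.Y⊆S x∈₁)
      ...   | inj₁ x∈A = ⊥-elim (anti x∈A b∈B (pwK _ _ x∈K b∈K λ { refl → A∩B x∈A b∈B }))
      ...   | inj₂ x∈E = q⊆p∪q X₂.Y E x∈E

  -- `D` collects all vertices of `C` complete to `A`, including those complete to both sides; by
  -- bicompleteness the remaining ones, `E`, are complete to `B`.
  bicomplete⇒division : ∀ {A B C} → Separation A B C → Bicomplete A B C →
                        (∀ S → S ⊂ V G → PerfectlyDivisible (G [ S ])) → Division (V G)
  bicomplete⇒division {A} {B} {C} sep bicomplete minimal =
    division-∪ sep D⊆C (p─q⊆p C D) C⁻ (λ x∈D x∈E → x∈p─q⇒x∉q C D x∈E x∈D) A~D B~E div₁ div₂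
    where
    open Separation sep
    inD? : ∀ c → Dec (c ∈ C × (∀ a → a ∈ A → c ~ a))
    inD? c = c ∈? C ×-dec all? λ a → a ∈? A →-dec c ~? a
    D E : Subset n
    D = comprehension inD?
    E = C ─ D
    D⊆C : D ⊆ C
    D⊆C x∈ = proj₁ (∈-comprehension⁻ inD? x∈)
    C⁻ : ∀ {x} → x ∈ C → x ∈ D ⊎ x ∈ E
    C⁻ {x} x∈C with x ∈? D
    ... | yes x∈D = inj₁ x∈D
    ... | no x∉D  = inj₂ (x∈p∧x∉q⇒x∈p─q x∈C x∉D)
    A~D : CompleteTo A D
    A~D a∈A d∈D = ~-sym (proj₂ (∈-comprehension⁻ inD? d∈D) _ a∈A)
    B~E : CompleteTo B E
    B~E b∈B e∈E with bicomplete (p─q⊆p C D e∈E)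
    ... | inj₂ e~B = ~-sym (e~B b∈B)
    ... | inj₁ e~A = ⊥-elim (x∈p─q⇒x∉q C D e∈E
      (∈-comprehension⁺ inD? (p─q⊆p C D e∈E , λ _ a∈A → e~A a∈A)))
    -- The vertex `q` witnesses that `P ∪ R` is a proper subset of `V G`, so minimality applies; `p`
    -- makes it nonempty, which covers the edgeless case.
    proper-division : ∀ {P Q R} → Nonempty P → Nonempty Q → P ⊆ V G → Q ⊆ V G → R ⊆ C →
                      (∀ {x} → x ∈ Q → x ∉ P) → (∀ {x} → x ∈ Q → x ∉ C) → Division (P ∪ R)
    proper-division {P} {Q} {R} (p , p∈P) (q , q∈Q) P⊆V Q⊆V R⊆C Q∩P Q∩C =
      perfectlyDivisible⇒division (p⊆p∪q R p∈P) (minimal (P ∪ R)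
        ((λ x∈ → [ (λ y → P⊆V y) , (λ y → C⊆V (R⊆C y)) ]′ (x∈p∪q⁻ P R x∈)) ,
         q , Q⊆V q∈Q , λ q∈ → [ Q∩P q∈Q , (λ y → Q∩C q∈Q (R⊆C y)) ]′ (x∈p∪q⁻ P R q∈)))
    div₁ : Division (A ∪ E)
    div₁ = proper-division A≠∅ B≠∅ A⊆V B⊆V (p─q⊆p C D) (λ x∈B x∈A → A∩B x∈A x∈B) B∩C
    div₂ : Division (B ∪ D)
    div₂ = proper-division B≠∅ A≠∅ B⊆V A⊆V D⊆C A∩B A∩C

  -- Minimality handles every proper induced subgraph, so a good partition of `G` itself is all that
  -- is missing.
  division⇒perfectlyDivisible : (∀ S → S ⊂ V G → PerfectlyDivisible (G [ S ])) →
                                Division (V G) → PerfectlyDivisible G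
  division⇒perfectlyDivisible minimal div S S⊆V edge
    with any? (λ x → x ∈? V G ×-dec ¬? (x ∈? S))
  ... | yes (x , x∈V , x∉S) = minimal S (S⊆V , x , x∈V , x∉S) S (λ y∈S → y∈S) edge
  ... | no V⊆S = fromDivision (subst Division (sym S≡V) div)
    where
    S≡V : S ≡ V G
    S≡V = ⊆-antisym S⊆V
      λ {x} x∈V → decidable-stable (x ∈? S) λ x∉S → V⊆S (x , x∈V , x∉S)

theorem2 : ∀ (n : ℕ) (G : Graph n) → P₅-free G → MinimallyNonPerfectlyDivisible G → ¬ (∃[ C ] IsCliqueCutset G C)
theorem2 n G free (¬divisible , minimal) (C , cutset)
  with A , B , C′ , sep , bicomplete ←
         bicompleteSeparation G free C (⊂-wellFounded C) (cutset⇒splits G cutset) =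
  ¬divisible (division⇒perfectlyDivisible G minimal (bicomplete⇒division G sep bicomplete minimal))
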